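{- There is an absolute constant $C>0$ such that for every positive integer $d$, the hypercube $Q_d$ is not $\frac{C\cdot 2^d}{d}$-minor-universal; that is, for every $d$ there exists a graph $H$ with no isolated vertices and at most $C\cdot 2^d/d$ edges such that $H$ is not a minor of $Q_d$.
   Context: The $d$-dimensional hypercube $Q_d$ is the graph whose vertices are the binary strings of length $d$, two vertices being adjacent whenever their Hamming distance is one. A graph $H$ is a minor of a graph $G$ if $H$ can be obtained from $G$ by a finite sequence of edge deletions, vertex deletions and edge contractions. A graph $G$ is called $m$-minor-universal if every graph $H$ with at most $m$ edges and no isolated vertices is a minor of $G$. -}

module Defs where

open import Data.Nat using (ℕ; zero; suc; _+_; _*_; _^_; _≤_; _<_)
open import Data.Bool using (Bool; true; false; _∧_; _∨_; not; if_then_else_)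
open import Data.Fin using (Fin; punchIn; punchOut; splitAt; _<?_)
open import Data.Fin.Properties using (_≟_)
open import Data.Vec using (Vec; []; _∷_)
open import Data.List using (List; map)
open import Data.Nat.ListAction using (sum)
open import Data.Nat using (_≡ᵇ_)
import Data.Bool.Properties as BP
open import Relation.Binary.PropositionalEquality using (refl; cong; cong₂)
open import Data.Fin.Base using () renaming (_<_ to _<ᶠ_)
open import Data.List.Base using (allFin)
open import Data.Sum using (_⊎_; inj₁; inj₂)
open import Data.Product using (Σ; ∃; _×_; _,_)
open import Relation.Nullary using (¬_; Dec; yes; no)
open import Relation.Nullary.Decidable using (⌊_⌋)
open import Relation.Binary.PropositionalEquality using (_≡_; _≢_)
open import Relation.Binary.Construct.Closure.ReflexiveTransitive using (Star)
open import Function.Bundles using (_↔_; Inverse)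

record Graph : Set where
  constructor mkG
  field
    n      : ℕ
    adj    : Fin n → Fin n → Bool
    sym    : ∀ x y → adj x y ≡ adj y x
    irrefl : ∀ x → adj x x ≡ false
open Graph public

edgeCount : Graph → ℕ
edgeCount G =
  sum (map (λ i → sum (map (λ j →
         if ⌊ i <? j ⌋ ∧ adj G i j then 1 else 0) (allFin (n G))))
       (allFin (n G)))

NoIsolated : Graph → Set
NoIsolated G = ∀ (x : Fin (n G)) → ∃ λ (y : Fin (n G)) → adj G x y ≡ true

_==_ : ∀ {m} → Fin m → Fin m → Bool
x == y = ⌊ x ≟ y ⌋

data Step : Graph → Graph → Set where
  iso  : ∀ {m a s i b t j} (σ : Fin m ↔ Fin m) →
         (∀ x y → a x y ≡ b (Inverse.to σ x) (Inverse.to σ y)) →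
         Step (mkG m a s i) (mkG m b t j)
  edel : ∀ {m a s i b t j} (u v : Fin m) → b u v ≡ true →
         (∀ x y → a x y ≡ (b x y ∧ not ((x == u ∧ y == v) ∨ (x == v ∧ y == u)))) →
         Step (mkG m a s i) (mkG m b t j)
  vdel : ∀ {m a s i b t j} (v : Fin (suc m)) →
         (∀ x y → a x y ≡ b (punchIn v x) (punchIn v y)) →
         Step (mkG m a s i) (mkG (suc m) b t j)
  -- contraction of the edge uv: v is merged into u (loops/multi-edges dropped)
  contr : ∀ {m a s i b t j} (u v : Fin (suc m)) (v≢u : v ≢ u) → b u v ≡ true →
         (∀ x y → x ≢ y →
            a x y ≡ (b (punchIn v x) (punchIn v y)
                     ∨ (x == punchOut v≢u ∧ b v (punchIn v y))
                     ∨ (y == punchOut v≢u ∧ b (punchIn v x) v))) →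
         Step (mkG m a s i) (mkG (suc m) b t j)

_≼_ : Graph → Graph → Set
H ≼ G = Star Step H G

-- The hypercube Q_d. Vertices are Fin (2^d), identified with binary
-- strings of length d via the bijection `bits` (first bit = top half).

bits : ∀ d → Fin (2 ^ d) → Vec Bool d
bits zero    _ = []
bits (suc d) x with splitAt (2 ^ d) x
... | inj₁ a = false ∷ bits d a
... | inj₂ b with splitAt (2 ^ d) b
...   | inj₁ c = true ∷ bits d c
...   | inj₂ ()

hamming : ∀ {d} → Vec Bool d → Vec Bool d → ℕ
hamming []       []       = 0
hamming (p ∷ ps) (q ∷ qs) = (if ⌊ Data.Bool._≟_ p q ⌋ then 0 else 1) + hamming ps qs

hamming-sym : ∀ {d} (u v : Vec Bool d) → hamming u v ≡ hamming v u
hamming-sym []       []       = refl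
hamming-sym (false ∷ ps) (false ∷ qs) = cong (0 +_) (hamming-sym ps qs)
hamming-sym (false ∷ ps) (true ∷ qs)  = cong (1 +_) (hamming-sym ps qs)
hamming-sym (true ∷ ps)  (false ∷ qs) = cong (1 +_) (hamming-sym ps qs)
hamming-sym (true ∷ ps)  (true ∷ qs)  = cong (0 +_) (hamming-sym ps qs)

hamming-self : ∀ {d} (u : Vec Bool d) → hamming u u ≡ 0
hamming-self []          = refl
hamming-self (false ∷ ps) = hamming-self ps
hamming-self (true ∷ ps)  = hamming-self ps

Q : ℕ → Graph
Q d = record
  { n      = 2 ^ d
  ; adj    = λ x y → hamming (bits d x) (bits d y) ≡ᵇ 1
  ; sym    = λ x y → cong (_≡ᵇ 1) (hamming-sym (bits d x) (bits d y))
  ; irrefl = λ x → cong (_≡ᵇ 1) (hamming-self (bits d x))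
  }

{-# OPTIONS --safe #-}
module Submission where

-- A counting argument.  Take p of order 2^d / d, p left and 2p right vertices, and 16 arbitrary
-- injections from left to right as edges: about p^(16p) graphs with O(p) edges and bounded
-- degree.  In a minor model in Q_d pick a root in every branch set.  The roots of adjacent
-- vertices u, v are at distance less than |B_u| + |B_v|, so summed over the edges of one injection
-- the distances are at most 2^d.  Hence a minor is determined by its 3p roots (3pd bits) and by the
-- differences of the roots along the edges, a word of 16pd bits of weight at most 16 * 2^d, which
-- is a small fraction of its length.  There are fewer than p^(16p) such pairs, as p is close to 2^d.

open import Defs
open import Data.Nat using (ℕ; _*_; _^_; _≤_; _<_)
open import Data.Product using (Σ; ∃; _×_)
open import Relation.Nullary using (¬_)

open import Algebra.Properties.CommutativeMonoid.Sum using ()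
open import Data.Bool using (Bool; true; false; _∧_; _∨_; _xor_; if_then_else_)
import Data.Bool as Bool
open import Data.Bool.Properties using (∧-zeroʳ; not-injective)
open import Data.Fin using (Fin; zero; suc; punchIn; punchOut; splitAt; join; _↑ˡ_; _↑ʳ_;
  combine; finToFun; funToFin; _<?_)
open import Data.Fin.Properties using (_≟_; any?; all?; ¬∀⟶∃¬; injective⇒≤; punchIn-injective;
  punchInᵢ≢i; punchIn-punchOut; splitAt-↑ˡ; splitAt-↑ʳ; join-splitAt; splitAt⁻¹-↑ˡ; splitAt⁻¹-↑ʳ;
  ↑ʳ-injective; funToFin-finToFin; toℕ-↑ˡ; toℕ-↑ʳ; toℕ<n)
open import Data.List as List using (List; []; _∷_)
open import Data.List.Membership.Propositional using (_∈_; lose)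
open import Data.List.Membership.Propositional.Properties
  using (∈-map⁺; ∈-++⁺ˡ; ∈-++⁺ʳ; ∈-cartesianProduct⁺)
open import Data.List.Properties using (length-map; length-++)
open import Data.List.Relation.Unary.Any as Any using (Any; here)
open import Data.List.Relation.Unary.Any.Properties using (lookup-index)
import Data.Nat.ListAction as ListAction
open import Data.Nat using (zero; suc; _+_; _∸_; z≤n; s≤s; NonZero)
open import Data.Nat.Properties hiding (_≟_; _<?_)
open import Data.Nat.Tactic.RingSolver using (solve-∀)
open import Data.Product using (_,_; proj₁; ∃₂)
open import Data.Sum using (_⊎_; inj₁; inj₂)
open import Data.Vec as Vec using (Vec; []; _∷_)
open import Data.Vec.Properties using (tabulate-cong; tabulate∘lookup; lookup∘tabulate;
  lookup-concat; ∷-injectiveˡ; ∷-injectiveʳ; ++-injectiveˡ; ++-injectiveʳ)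
  renaming (≡-dec to Vec-≡-dec)
open import Function using (_∘_; id; Inverse; Injection)
open import Function.Properties.Inverse using (↔⇒↣)
open import Relation.Binary.Construct.Closure.ReflexiveTransitive using (Star; ε; _◅_)
open import Relation.Binary.PropositionalEquality
  using (_≡_; refl; trans; cong; cong₂; subst; subst₂) renaming (sym to ≡-sym)
open import Relation.Nullary using (Dec; yes; no; contradiction)
open import Relation.Nullary.Decidable using (⌊_⌋; _×-dec_; _→-dec_; isYes)

open Algebra.Properties.CommutativeMonoid.Sum +-0-commutativeMonoid
  using (sum; sum-remove; ∑-distrib-+; ∑-comm; ∑-permute)

-- Booleans and finite sums.

∨-true : ∀ a {b} → a ∨ b ≡ true → a ≡ true ⊎ b ≡ true
∨-true true  _ = inj₁ refl
∨-true false e = inj₂ e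

∧-true : ∀ a {b} → a ∧ b ≡ true → a ≡ true × b ≡ true
∧-true true e = refl , e

isYes-true : ∀ {A : Set} {a? : Dec A} → isYes a? ≡ true → A
isYes-true {a? = yes a} _ = a

isYes-yes : ∀ {A : Set} {a? : Dec A} → A → isYes a? ≡ true
isYes-yes {a? = yes _} _ = refl
isYes-yes {a? = no ¬a} a = contradiction a ¬a

sum-mono : ∀ {m} {f g : Fin m → ℕ} → (∀ i → f i ≤ g i) → sum f ≤ sum g
sum-mono {zero}  _ = z≤n
sum-mono {suc m} h = +-mono-≤ (h zero) (sum-mono (h ∘ suc))

sum-≤-* : ∀ {m} {f : Fin m → ℕ} {c} → (∀ i → f i ≤ c) → sum f ≤ m * c
sum-≤-* {zero}  _ = z≤n
sum-≤-* {suc m} h = +-mono-≤ (h zero) (sum-≤-* (h ∘ suc))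

term≤sum : ∀ {m} (f : Fin m → ℕ) i → f i ≤ sum f
term≤sum f zero    = m≤m+n _ _
term≤sum f (suc i) = ≤-trans (term≤sum (f ∘ suc) i) (m≤n+m _ _)

sum-0 : ∀ {m} {f : Fin m → ℕ} → (∀ i → f i ≤ 0) → sum f ≤ 0
sum-0 {m} h = ≤-trans (sum-≤-* h) (≤-reflexive (*-zeroʳ m))

sum-splitAt : ∀ m {k} (f : Fin (m + k) → ℕ) →
              sum f ≡ sum (λ i → f (i ↑ˡ k)) + sum (λ j → f (m ↑ʳ j))
sum-splitAt zero    f = refl
sum-splitAt (suc m) f =
  trans (cong (f zero +_) (sum-splitAt m (f ∘ suc))) (≡-sym (+-assoc (f zero) _ _))

sum-indicator : ∀ {m} (c : Fin m) s → sum (λ x → if x == c then s else 0) ≤ s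
sum-indicator {suc m} c s = begin
  sum δ                          ≡⟨ sum-remove {i = c} δ ⟩
  δ c + sum (δ ∘ punchIn c)      ≤⟨ +-mono-≤ (δ≤s c) (sum-0 off) ⟩
  s + 0                          ≡⟨ +-identityʳ s ⟩
  s                              ∎
  where
  open ≤-Reasoning
  δ : Fin (suc m) → ℕ
  δ x = if x == c then s else 0
  δ≤s : ∀ x → δ x ≤ s
  δ≤s x with x ≟ c
  ... | yes _ = ≤-refl
  ... | no  _ = z≤n
  off : ∀ j → δ (punchIn c j) ≤ 0
  off j with punchIn c j ≟ c
  ... | yes e = contradiction e (punchInᵢ≢i c j)
  ... | no  _ = z≤n

list-sum-≤ : ∀ {m} {A : Set} (t : Fin m → A) {f : A → ℕ} {g : Fin m → ℕ} →
             (∀ i → f (t i) ≤ g i) → ListAction.sum (List.map f (List.tabulate t)) ≤ sum g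
list-sum-≤ {zero}  t h = z≤n
list-sum-≤ {suc m} t h = +-mono-≤ (h zero) (list-sum-≤ (t ∘ suc) (h ∘ suc))

-- The Hamming metric on binary strings.

hamming-triangle : ∀ {d} (u v w : Vec Bool d) → hamming u w ≤ hamming u v + hamming v w
hamming-triangle []       []       []       = z≤n
hamming-triangle (a ∷ as) (b ∷ bs) (c ∷ cs) =
  ≤-trans (+-mono-≤ (bit a b c) (hamming-triangle as bs cs))
          (≤-reflexive (swap (δ a b) (δ b c) (hamming as bs) (hamming bs cs)))
  where
  δ : Bool → Bool → ℕ
  δ a b = if ⌊ a Bool.≟ b ⌋ then 0 else 1
  bit : ∀ a b c → δ a c ≤ δ a b + δ b c
  bit false b     false = z≤n
  bit true  b     true  = z≤n
  bit false false true  = ≤-refl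
  bit false true  true  = ≤-refl
  bit true  false false = ≤-refl
  bit true  true  false = ≤-refl
  swap : ∀ a b c d → (a + b) + (c + d) ≡ (a + c) + (b + d)
  swap = solve-∀

bits-injective : ∀ d (x y : Fin (2 ^ d)) → bits d x ≡ bits d y → x ≡ y
bits-injective zero    zero zero _ = refl
bits-injective (suc d) x y e
  with splitAt (2 ^ d) x | join-splitAt (2 ^ d) _ x | splitAt (2 ^ d) y | join-splitAt (2 ^ d) _ y
... | inj₁ a | refl | inj₁ b | refl = cong (_↑ˡ _) (bits-injective d a b (∷-injectiveʳ e))
... | inj₁ _ | _    | inj₂ b | _ with splitAt (2 ^ d) b
...   | inj₁ _ = contradiction (∷-injectiveˡ e) λ ()
bits-injective (suc d) x y e
    | inj₂ a | _    | inj₁ _ | _ with splitAt (2 ^ d) a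
...   | inj₁ _ = contradiction (∷-injectiveˡ e) λ ()
bits-injective (suc d) x y e
    | inj₂ a | refl | inj₂ b | refl
  with splitAt (2 ^ d) a | join-splitAt (2 ^ d) _ a | splitAt (2 ^ d) b | join-splitAt (2 ^ d) _ b
...   | inj₁ a′ | refl | inj₁ b′ | refl =
        cong (λ z → (2 ^ d) ↑ʳ (z ↑ˡ _)) (bits-injective d a′ b′ (∷-injectiveʳ e))

-- Minor models in the cube and their stability under minor operations.

-- A minor model with branch sets B u; size u stands for |B u|.  Distances are measured in the cube,
-- so connectedness of B u enters only through its diameter.
record Model (d : ℕ) (H : Graph) : Set₁ where
  field
    B        : Fin (n H) → Vec Bool d → Set
    size     : Fin (n H) → ℕ
    total    : sum size ≤ 2 ^ d
    root     : Fin (n H) → Vec Bool d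
    root∈    : ∀ u → B u (root u)
    disjoint : ∀ {u v w} → B u w → B v w → u ≡ v
    diam     : ∀ {u w z} → B u w → B u z → hamming w z < size u
    edge     : ∀ {u v} → adj H u v ≡ true → ∃₂ λ w z → B u w × B v z × hamming w z ≤ 1

-- Walk from `w` to the end of a joining edge inside `B u`, cross that edge, and walk on to `z`
-- inside `B v`. Both diameters are strictly below the sizes, which absorbs the crossing and still
-- leaves a strict inequality. This serves both for contractions and for the final distance bound.
adjacent-branches : ∀ {d H} (M : Model d H) {u v w z} → adj H u v ≡ true →
                    Model.B M u w → Model.B M v z → hamming w z < Model.size M u + Model.size M v
adjacent-branches M {u} {v} {w} {z} uv p q with Model.edge M uv
... | w₀ , z₀ , p₀ , q₀ , h = begin-strict
  hamming w z                                        ≤⟨ hamming-triangle w w₀ z ⟩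
  hamming w w₀ + hamming w₀ z                        ≤⟨ +-monoʳ-≤ _ (hamming-triangle w₀ z₀ z) ⟩
  hamming w w₀ + (hamming w₀ z₀ + hamming z₀ z)      ≤⟨ +-monoʳ-≤ _ (+-monoˡ-≤ _ h) ⟩
  hamming w w₀ + suc (hamming z₀ z)                  <⟨ +-mono-<-≤ (diam p p₀) (diam q₀ q) ⟩
  size u + size v                                    ∎
  where
  open ≤-Reasoning
  open Model M

trivial-model : ∀ d → Model d (Q d)
trivial-model d = record
  { B        = λ u w → bits d u ≡ w
  ; size     = λ _ → 1
  ; total    = ≤-trans (sum-≤-* {m = 2 ^ d} {c = 1} λ _ → ≤-refl) (≤-reflexive (*-identityʳ (2 ^ d)))
  ; root     = bits d
  ; root∈    = λ _ → refl
  ; disjoint = λ {u} {v} p q → bits-injective d u v (trans p (≡-sym q))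
  ; diam     = λ {u} p q → ≤-reflexive
                 (cong suc (trans (cong₂ hamming (≡-sym p) (≡-sym q)) (hamming-self (bits d u))))
  ; edge     = λ {u} {v} e → bits d u , bits d v , refl , refl
                 , ≤-reflexive (≡ᵇ⇒≡ _ 1 (subst Bool.T (≡-sym e) _))
  }

-- Models are pulled back from the larger graph to the smaller one. Isomorphism and deletions only
-- reindex or restrict the branch sets; contraction merges `B v` into the branch set of `u`.
step-model : ∀ {d G H} → Step H G → Model d G → Model d H
step-model {d} (iso {m} σ eq) M = record
  { B        = B ∘ to
  ; size     = size ∘ to
  ; total    = ≤-trans (≤-reflexive (≡-sym (∑-permute size σ))) total
  ; root     = root ∘ to
  ; root∈    = root∈ ∘ to
  ; disjoint = λ p q → Injection.injective (↔⇒↣ σ) (disjoint p q)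
  ; diam     = diam
  ; edge     = λ {u} {v} e → edge (trans (≡-sym (eq u v)) e)
  }
  where
  open Model M
  to = Inverse.to σ
step-model (edel u v _ eq) M = record
  { B = B ; size = size ; total = total ; root = root ; root∈ = root∈
  ; disjoint = disjoint ; diam = diam
  ; edge     = λ {x} {y} e → edge (proj₁ (∧-true _ (trans (≡-sym (eq x y)) e)))
  }
  where open Model M
step-model (vdel v eq) M = record
  { B        = B ∘ punchIn v
  ; size     = size ∘ punchIn v
  ; total    = ≤-trans (m≤n+m _ (size v)) (≤-trans (≤-reflexive (≡-sym (sum-remove {i = v} size))) total)
  ; root     = root ∘ punchIn v
  ; root∈    = root∈ ∘ punchIn v
  ; disjoint = λ p q → punchIn-injective v _ _ (disjoint p q)
  ; diam     = diam
  ; edge     = λ {x} {y} e → edge (trans (≡-sym (eq x y)) e)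
  }
  where open Model M
step-model {d} (contr {m} {a} {s} {i} {b} {t} u v v≢u uv eq) M = record
  { B        = B′
  ; size     = size′
  ; total    = total′
  ; root     = root ∘ punchIn v
  ; root∈    = inj₁ ∘ root∈ ∘ punchIn v
  ; disjoint = disjoint′
  ; diam     = diam′
  ; edge     = λ {x} {y} → edge′ x y
  }
  where
  open Model M
  c = punchOut v≢u
  in-c : punchIn v c ≡ u
  in-c = punchIn-punchOut v≢u
  B′ : Fin m → Vec Bool d → Set
  B′ x w = B (punchIn v x) w ⊎ (x ≡ c × B v w)
  size′ : Fin m → ℕ
  -- The merged vertex receives the size of `v`, so the total does not grow.
  size′ x = size (punchIn v x) + (if x == c then size v else 0)
  size-c : size u + size v ≤ size′ c
  size-c = ≤-reflexive (≡-sym (cong₂ (λ w b → size w + (if b then size v else 0)) in-c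
                               (isYes-yes {a? = c ≟ c} refl)))
  total′ : sum size′ ≤ 2 ^ d
  total′ = begin
    sum size′
      ≡⟨ ∑-distrib-+ (size ∘ punchIn v) (λ x → if x == c then size v else 0) ⟩
    sum (size ∘ punchIn v) + sum (λ x → if x == c then size v else 0)
      ≤⟨ +-monoʳ-≤ _ (sum-indicator c (size v)) ⟩
    sum (size ∘ punchIn v) + size v
      ≡⟨ +-comm (sum (size ∘ punchIn v)) (size v) ⟩
    size v + sum (size ∘ punchIn v)
      ≡⟨ sum-remove {i = v} size ⟨
    sum size
      ≤⟨ total ⟩
    2 ^ d ∎
    where open ≤-Reasoning
  disjoint′ : ∀ {x y w} → B′ x w → B′ y w → x ≡ y
  disjoint′ (inj₁ p) (inj₁ q) = punchIn-injective v _ _ (disjoint p q)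
  disjoint′ (inj₁ p) (inj₂ (_ , q)) = contradiction (disjoint p q) (punchInᵢ≢i v _)
  disjoint′ (inj₂ (_ , p)) (inj₁ q) = contradiction (disjoint q p) (punchInᵢ≢i v _)
  disjoint′ (inj₂ (p , _)) (inj₂ (q , _)) = trans p (≡-sym q)
  -- Points from the two old halves of the merged set are compared across the contracted edge.
  bridge : ∀ {w z} → B u w → B v z → hamming w z < size u + size v
  bridge = adjacent-branches M uv
  diam′ : ∀ {x w z} → B′ x w → B′ x z → hamming w z < size′ x
  diam′ (inj₁ p) (inj₁ q) = ≤-trans (diam p q) (m≤m+n _ _)
  diam′ (inj₁ p) (inj₂ (refl , q)) =
    ≤-trans (bridge (subst (λ u → B u _) in-c p) q) size-c
  diam′ {w = w} {z} (inj₂ (refl , p)) (inj₁ q) =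
    subst (_< _) (hamming-sym z w) (≤-trans (bridge (subst (λ u → B u _) in-c q) p) size-c)
  diam′ (inj₂ (refl , p)) (inj₂ (_ , q)) =
    ≤-trans (diam p q) (≤-trans (m≤n+m _ (size u)) size-c)
  edge′ : ∀ x y → a x y ≡ true → ∃₂ λ w z → B′ x w × B′ y z × hamming w z ≤ 1
  edge′ x y e with x ≟ y
  -- The adjacency after contraction is prescribed off the diagonal only; on it, irreflexivity
  -- excludes an edge.
  ... | yes refl = contradiction (trans (≡-sym e) (i x)) λ ()
  ... | no x≢y with ∨-true (b (punchIn v x) (punchIn v y)) (trans (≡-sym (eq x y x≢y)) e)
  ...   | inj₁ e₁ = let w , z , p , q , h = edge e₁ in w , z , inj₁ p , inj₁ q , h
  ...   | inj₂ e₂ with ∨-true (x == c ∧ b v (punchIn v y)) e₂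
  ...     | inj₁ e₃ = let x≡c , e₄ = ∧-true (x == c) e₃
                          w , z , p , q , h = edge e₄
                      in w , z , inj₂ (isYes-true x≡c , p) , inj₁ q , h
  ...     | inj₂ e₃ = let y≡c , e₄ = ∧-true (y == c) e₃
                          w , z , p , q , h = edge e₄
                      in w , z , inj₁ p , inj₂ (isYes-true y≡c , q) , h

minor-model : ∀ {d H} → H ≼ Q d → Model d H
minor-model {d} = go
  where
  go : ∀ {H} → Star Step H (Q d) → Model d H
  go ε        = trivial-model d
  go (s ◅ ss) = step-model s (go ss)

-- Bipartite graphs given by neighbour lists.

-- Adjacency asks whether a right vertex occurs in the list of a left one, so repeated entries yield
-- a single edge.
bipartite : ∀ {l r e} → (Fin l → Fin e → Fin r) → Graph
bipartite {l} {r} {e} nb = mkG (l + r) (λ x y → a (splitAt l x) (splitAt l y))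
  (λ x y → a-sym (splitAt l x) (splitAt l y)) (λ x → a-irrefl (splitAt l x))
  where
  hit : Fin l → Fin r → Bool
  hit i j = isYes (any? λ c → j ≟ nb i c)
  a : Fin l ⊎ Fin r → Fin l ⊎ Fin r → Bool
  a (inj₁ i) (inj₂ j) = hit i j
  a (inj₂ j) (inj₁ i) = hit i j
  a _        _        = false
  a-sym : ∀ x y → a x y ≡ a y x
  a-sym (inj₁ _) (inj₁ _) = refl
  a-sym (inj₁ _) (inj₂ _) = refl
  a-sym (inj₂ _) (inj₁ _) = refl
  a-sym (inj₂ _) (inj₂ _) = refl
  a-irrefl : ∀ x → a x x ≡ false
  a-irrefl (inj₁ _) = refl
  a-irrefl (inj₂ _) = refl

module _ {l r e} (nb : Fin l → Fin e → Fin r) where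

  bipartite-adj : ∀ i c → adj (bipartite nb) (i ↑ˡ r) (l ↑ʳ nb i c) ≡ true
  bipartite-adj i c rewrite splitAt-↑ˡ l i r | splitAt-↑ʳ l r (nb i c) = isYes-yes (c , refl)

  bipartite-noIsolated : Fin e → (∀ j → ∃₂ λ i c → nb i c ≡ j) → NoIsolated (bipartite nb)
  bipartite-noIsolated c₀ onto x = subst HasNeighbour (join-splitAt l r x) (neighbour (splitAt l x))
    where
    HasNeighbour : Fin (l + r) → Set
    HasNeighbour x = ∃ λ y → adj (bipartite nb) x y ≡ true
    neighbour : ∀ s → HasNeighbour (join l r s)
    neighbour (inj₁ i) = l ↑ʳ nb i c₀ , bipartite-adj i c₀
    neighbour (inj₂ j) with onto j
    ... | i , c , refl = i ↑ˡ r ,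
      trans (Graph.sym (bipartite nb) (l ↑ʳ nb i c) (i ↑ˡ r)) (bipartite-adj i c)

  -- Left vertices precede right ones in `Fin (l + r)`, so each edge is counted in the row of its
  -- left end. Such a row is bounded by counting pairs of a list position and the right vertex found
  -- there, at most one per position.
  bipartite-edgeCount : edgeCount (bipartite nb) ≤ l * e
  bipartite-edgeCount = begin
    edgeCount (bipartite nb)
      ≤⟨ list-sum-≤ id {f = λ x → ListAction.sum (List.map (up x) (List.allFin (l + r)))}
           (λ x → list-sum-≤ id {f = up x} (λ y → ≤-refl)) ⟩
    sum (λ x → sum (up x))
      ≡⟨ sum-splitAt l _ ⟩
    sum (λ i → sum (up (i ↑ˡ r))) + sum (λ j → sum (up (l ↑ʳ j)))
      ≤⟨ +-mono-≤ (sum-≤-* row-left) (sum-0 row-right) ⟩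
    l * e + 0
      ≡⟨ +-identityʳ (l * e) ⟩
    l * e ∎
    where
    open ≤-Reasoning
    up : Fin (l + r) → Fin (l + r) → ℕ
    up x y = if ⌊ x <? y ⌋ ∧ adj (bipartite nb) x y then 1 else 0
    left-left : ∀ i i′ → up (i ↑ˡ r) (i′ ↑ˡ r) ≤ 0
    left-left i i′ rewrite splitAt-↑ˡ l i r | splitAt-↑ˡ l i′ r | ∧-zeroʳ ⌊ (i ↑ˡ r) <? (i′ ↑ˡ r) ⌋ = z≤n
    right-right : ∀ j j′ → up (l ↑ʳ j) (l ↑ʳ j′) ≤ 0
    right-right j j′ rewrite splitAt-↑ʳ l r j | splitAt-↑ʳ l r j′ | ∧-zeroʳ ⌊ (l ↑ʳ j) <? (l ↑ʳ j′) ⌋ = z≤n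
    right-left : ∀ j i → up (l ↑ʳ j) (i ↑ˡ r) ≤ 0
    right-left j i with (l ↑ʳ j) <? (i ↑ˡ r)
    ... | no _ = z≤n
    ... | yes lt = contradiction (subst₂ _<_ (toℕ-↑ʳ l j) (toℕ-↑ˡ i r) lt)
                                 (≤⇒≯ (≤-trans (<⇒≤ (toℕ<n i)) (m≤m+n l _)))
    left-right : ∀ i j → up (i ↑ˡ r) (l ↑ʳ j) ≤ sum (λ c → if j == nb i c then 1 else 0)
    left-right i j rewrite splitAt-↑ˡ l i r | splitAt-↑ʳ l r j with any? (λ c → j ≟ nb i c)
    ... | no _ rewrite ∧-zeroʳ ⌊ (i ↑ˡ r) <? (l ↑ʳ j) ⌋ = z≤n
    ... | yes (c , j≡) = ≤-trans (indicator≤1 _) (≤-trans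
            (≤-reflexive (cong (if_then 1 else 0) (≡-sym (isYes-yes {a? = j ≟ nb i c} j≡))))
            (term≤sum (λ c → if j == nb i c then 1 else 0) c))
      where
      indicator≤1 : ∀ b → (if b then 1 else 0) ≤ 1
      indicator≤1 true  = ≤-refl
      indicator≤1 false = z≤n
    row-left : ∀ i → sum (up (i ↑ˡ r)) ≤ e
    row-left i = begin
      sum (up (i ↑ˡ r))
        ≡⟨ sum-splitAt l _ ⟩
      sum (λ i′ → up (i ↑ˡ r) (i′ ↑ˡ r)) + sum (λ j → up (i ↑ˡ r) (l ↑ʳ j))
        ≤⟨ +-mono-≤ (sum-0 (left-left i)) (sum-mono (left-right i)) ⟩
      sum (λ j → sum (λ c → if j == nb i c then 1 else 0))
        ≡⟨ ∑-comm (λ j c → if j == nb i c then 1 else 0) ⟩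
      sum (λ c → sum (λ j → if j == nb i c then 1 else 0))
        ≤⟨ sum-≤-* (λ c → sum-indicator (nb i c) 1) ⟩
      e * 1
        ≡⟨ *-identityʳ e ⟩
      e ∎
    row-right : ∀ j → sum (up (l ↑ʳ j)) ≤ 0
    row-right j = begin
      sum (up (l ↑ʳ j))
        ≡⟨ sum-splitAt l _ ⟩
      sum (λ i → up (l ↑ʳ j) (i ↑ˡ r)) + sum (λ j′ → up (l ↑ʳ j) (l ↑ʳ j′))
        ≤⟨ +-mono-≤ (sum-0 (right-left j)) (sum-0 (right-right j)) ⟩
      0 ∎

-- Weights of binary words and the number of words of small weight.

weight : ∀ {m} → Vec Bool m → ℕ
weight []       = 0
weight (b ∷ bs) = (if b then 1 else 0) + weight bs

weight≤length : ∀ {m} (v : Vec Bool m) → weight v ≤ m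
weight≤length []          = z≤n
weight≤length (false ∷ v) = ≤-trans (weight≤length v) (n≤1+n _)
weight≤length (true  ∷ v) = s≤s (weight≤length v)

weight-++ : ∀ {m k} (u : Vec Bool m) (v : Vec Bool k) → weight (u Vec.++ v) ≡ weight u + weight v
weight-++ []      v = refl
weight-++ (b ∷ u) v = trans (cong (β +_) (weight-++ u v)) (≡-sym (+-assoc β (weight u) (weight v)))
  where β = if b then 1 else 0

weight-concat : ∀ {m k} (f : Fin m → Vec Bool k) →
                weight (Vec.concat (Vec.tabulate f)) ≡ sum (weight ∘ f)
weight-concat {zero}  f = refl
weight-concat {suc m} f =
  trans (weight-++ (f zero) _) (cong (weight (f zero) +_) (weight-concat (f ∘ suc)))

weight-xor : ∀ {m} (u v : Vec Bool m) → weight (Vec.zipWith _xor_ u v) ≡ hamming u v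
weight-xor []          []          = refl
weight-xor (false ∷ u) (false ∷ v) = weight-xor u v
weight-xor (false ∷ u) (true  ∷ v) = cong suc (weight-xor u v)
weight-xor (true  ∷ u) (false ∷ v) = cong suc (weight-xor u v)
weight-xor (true  ∷ u) (true  ∷ v) = weight-xor u v

-- Words of weight at most `w`, listed by Pascal's recursion on the first bit.
sparse : (m w : ℕ) → List (Vec Bool m)
sparse zero    w       = [] ∷ []
sparse (suc m) zero    = List.map (false ∷_) (sparse m zero)
sparse (suc m) (suc w) = List.map (false ∷_) (sparse m (suc w)) List.++ List.map (true ∷_) (sparse m w)

∈-sparse : ∀ {m w} (v : Vec Bool m) → weight v ≤ w → v ∈ sparse m w
∈-sparse         []          _       = here refl
∈-sparse {w = zero}  (false ∷ v) h       = ∈-map⁺ _ (∈-sparse v h)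
∈-sparse {w = suc w} (false ∷ v) h       = ∈-++⁺ˡ (∈-map⁺ _ (∈-sparse v h))
∈-sparse {w = suc w} (true  ∷ v) (s≤s h) = ∈-++⁺ʳ _ (∈-map⁺ _ (∈-sparse v h))

-- Chernoff: each word of weight at most w contributes t ^ (m ∸ weight) ≥ t ^ (m ∸ w) to (1 + t) ^ m.
length-sparse : ∀ t .{{_ : NonZero t}} m w →
                List.length (sparse m w) * t ^ m ≤ t ^ w * suc t ^ m
length-sparse t zero w = ≤-trans (m^n>0 t w) (≤-reflexive (≡-sym (*-identityʳ (t ^ w))))
length-sparse t (suc m) zero = begin
  List.length (List.map (false ∷_) (sparse m zero)) * (t * t ^ m)
    ≡⟨ cong (_* (t * t ^ m)) (length-map (false ∷_) (sparse m zero)) ⟩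
  L * (t * t ^ m)             ≡⟨ rearrange L t (t ^ m) ⟩
  t * (L * t ^ m)             ≤⟨ *-mono-≤ (n≤1+n t) (length-sparse t m zero) ⟩
  suc t * (1 * suc t ^ m)     ≡⟨ rearrange′ t (suc t ^ m) ⟩
  1 * (suc t * suc t ^ m)     ∎
  where
  open ≤-Reasoning
  L = List.length (sparse m zero)
  rearrange : ∀ a b c → a * (b * c) ≡ b * (a * c)
  rearrange = solve-∀
  rearrange′ : ∀ t c → suc t * (1 * c) ≡ 1 * (suc t * c)
  rearrange′ = solve-∀
length-sparse t (suc m) (suc w) = begin
  List.length (List.map (false ∷_) (sparse m (suc w)) List.++ List.map (true ∷_) (sparse m w)) * (t * t ^ m)
    ≡⟨ cong (_* (t * t ^ m)) (trans (length-++ (List.map (false ∷_) (sparse m (suc w))))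
         (cong₂ _+_ (length-map (false ∷_) (sparse m (suc w))) (length-map (true ∷_) (sparse m w)))) ⟩
  (L₀ + L₁) * (t * t ^ m)                                    ≡⟨ rearrange L₀ L₁ t (t ^ m) ⟩
  t * (L₀ * t ^ m) + t * (L₁ * t ^ m)
    ≤⟨ +-mono-≤ (*-monoʳ-≤ t (length-sparse t m (suc w))) (*-monoʳ-≤ t (length-sparse t m w)) ⟩
  t * (t * t ^ w * suc t ^ m) + t * (t ^ w * suc t ^ m)      ≡⟨ rearrange′ t (t ^ w) (suc t ^ m) ⟩
  t * t ^ w * (suc t * suc t ^ m)                            ∎
  where
  open ≤-Reasoning
  L₀ = List.length (sparse m (suc w))
  L₁ = List.length (sparse m w)
  rearrange : ∀ a b t c → (a + b) * (t * c) ≡ t * (a * c) + t * (b * c)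
  rearrange = solve-∀
  rearrange′ : ∀ t a b → t * (t * a * b) + t * (a * b) ≡ t * a * (suc t * b)
  rearrange′ = solve-∀

-- Pigeonhole for lists of codes.

length-cartesianProduct : ∀ {A B : Set} (xs : List A) (ys : List B) →
  List.length (List.cartesianProduct xs ys) ≡ List.length xs * List.length ys
length-cartesianProduct []       ys = refl
length-cartesianProduct (x ∷ xs) ys = trans (length-++ (List.map (x ,_) ys))
  (cong₂ _+_ (length-map (x ,_) ys) (length-cartesianProduct xs ys))

-- If every `x` had a code in the list, the index of that code would be an injection into a smaller
-- set, as a code determines its `x`. Decidability turns this contradiction into an explicit
-- witness.
uncoded : ∀ {m} {Y : Set} (ys : List Y) (R : Fin m → Y → Set) → (∀ x y → Dec (R x y)) →
          (∀ y {x x′} → R x y → R x′ y → x ≡ x′) → List.length ys < m →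
          ∃ λ x → ¬ Any (R x) ys
uncoded ys R R? functional lt = ¬∀⟶∃¬ _ _ (λ x → Any.any? (R? x) ys) λ all →
  <⇒≱ lt (injective⇒≤ {f = λ x → Any.index (all x)} λ {x} {x′} eq →
    functional _ (lookup-index (all x))
                 (subst (R x′ ∘ List.lookup ys) (≡-sym eq) (lookup-index (all x′))))

-- Numbers as functions, words as injections, and cancellation laws for vectors.

funToFin-cong : ∀ {m k} {f g : Fin m → Fin k} → (∀ i → f i ≡ g i) → funToFin f ≡ funToFin g
funToFin-cong {zero}  _ = refl
funToFin-cong {suc m} h = cong₂ combine (h zero) (funToFin-cong (h ∘ suc))

finToFun-injective : ∀ {m k} {x y : Fin (k ^ m)} → (∀ i → finToFun {k} {m} x i ≡ finToFun y i) → x ≡ y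
finToFun-injective {m} {k} h = trans (≡-sym (funToFin-finToFin {m} {k} _))
  (trans (funToFin-cong h) (funToFin-finToFin {m} {k} _))

-- Turns an arbitrary word f into an injective one: at each step the elements from the top p
-- available positions are offered, and the chosen position is skipped afterwards.
spread : ∀ {p} j → (Fin j → Fin p) → Fin j → Fin (j + p)
spread (suc j) f zero    = suc j ↑ʳ f zero
spread (suc j) f (suc i) = punchIn (suc j ↑ʳ f zero) (spread j (f ∘ suc) i)

-- Concerns the encoding `f ↦ spread j f`, not the values of one word. The value at `zero` reveals
-- the first letter; once it is known, its `punchIn` cancels from all later values.
spread-injective : ∀ {p} j {f g : Fin j → Fin p} → (∀ i → spread j f i ≡ spread j g i) →
                   ∀ i → f i ≡ g i
spread-injective (suc j) h zero = ↑ʳ-injective (suc j) _ _ (h zero)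
spread-injective (suc j) {f} {g} h (suc i) = spread-injective j tails i
  where
  tails : ∀ i → spread j (f ∘ suc) i ≡ spread j (g ∘ suc) i
  tails i = punchIn-injective (suc j ↑ʳ f zero) _ _
    (trans (h (suc i)) (cong (λ z → punchIn z (spread j (g ∘ suc) i)) (≡-sym (h zero))))

-- Each chosen position is removed from `s` before the next choice, so no summand is used twice.
-- Hence one injection charges each right vertex at most once.
sum-spread-≤ : ∀ {p} j (f : Fin j → Fin p) (s : Fin (j + p) → ℕ) → sum (s ∘ spread j f) ≤ sum s
sum-spread-≤ zero    f s = z≤n
sum-spread-≤ (suc j) f s = ≤-trans
  (+-monoʳ-≤ (s a) (sum-spread-≤ j (f ∘ suc) (s ∘ punchIn a)))
  (≤-reflexive (≡-sym (sum-remove {i = a} s)))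
  where a = suc j ↑ʳ f zero

concat-injective : ∀ {A : Set} {m k} {xss yss : Vec (Vec A k) m} →
                   Vec.concat xss ≡ Vec.concat yss → xss ≡ yss
concat-injective {xss = []}       {[]}       _  = refl
concat-injective {xss = xs ∷ xss} {ys ∷ yss} eq =
  cong₂ _∷_ (++-injectiveˡ xs ys eq) (concat-injective (++-injectiveʳ xs ys eq))

tabulate-injective : ∀ {A : Set} {m} {f g : Fin m → A} → Vec.tabulate f ≡ Vec.tabulate g →
                     ∀ i → f i ≡ g i
tabulate-injective {f = f} {g} eq i = trans (≡-sym (lookup∘tabulate f i))
  (trans (cong (λ v → Vec.lookup v i) eq) (lookup∘tabulate g i))

xor-cancelˡ : ∀ {m} (u : Vec Bool m) {v w} → Vec.zipWith _xor_ u v ≡ Vec.zipWith _xor_ u w → v ≡ w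
xor-cancelˡ []          {[]}    {[]}    _  = refl
xor-cancelˡ (false ∷ u) {_ ∷ _} {_ ∷ _} eq =
  cong₂ _∷_ (∷-injectiveˡ eq) (xor-cancelˡ u (∷-injectiveʳ eq))
xor-cancelˡ (true ∷ u)  {_ ∷ _} {_ ∷ _} eq =
  cong₂ _∷_ (not-injective (∷-injectiveˡ eq)) (xor-cancelˡ u (∷-injectiveʳ eq))

-- The family of graphs and its encoding by cube models.

module Family (p k : ℕ) where

  V : ℕ
  V = p + (p + p)

  -- A tuple of `k` functions from `Fin p` to itself, packed into one number so that the size of the
  -- family is visible for the pigeonhole argument.
  Word : Set
  Word = Fin ((p ^ p) ^ k)

  -- `spread p` needs exactly `p + p` values, which is why there are twice as many right vertices as
  -- left ones.
  target : Word → Fin k → Fin p → Fin (p + p)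
  target x c = spread p (finToFun {p} {p} (finToFun {p ^ p} {k} x c))

  target-injective : ∀ {x y} → (∀ c i → target x c i ≡ target y c i) → x ≡ y
  target-injective h =
    finToFun-injective {k} {p ^ p} λ c → finToFun-injective {p} {p} (spread-injective p (h c))

  -- The first two neighbours only serve to make every right vertex non-isolated.
  neighbours : Word → Fin p → Fin (2 + k) → Fin (p + p)
  neighbours x i zero          = i ↑ˡ p
  neighbours x i (suc zero)    = p ↑ʳ i
  neighbours x i (suc (suc c)) = target x c i

  family : Word → Graph
  family x = bipartite (neighbours x)

  family-noIsolated : ∀ x → NoIsolated (family x)
  family-noIsolated x = bipartite-noIsolated (neighbours x) zero onto
    where
    onto : ∀ j → ∃₂ λ i c → neighbours x i c ≡ j
    onto j with splitAt p j in eq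
    ... | inj₁ i = i , zero     , splitAt⁻¹-↑ˡ eq
    ... | inj₂ i = i , suc zero , splitAt⁻¹-↑ʳ eq

  module _ (d : ℕ) where

    differences : (Fin V → Vec Bool d) → Word → Vec Bool (k * (p * d))
    differences ρ x = Vec.concat (Vec.tabulate λ c → Vec.concat (Vec.tabulate λ i →
      Vec.zipWith _xor_ (ρ (i ↑ˡ (p + p))) (ρ (p ↑ʳ target x c i))))

    -- The root of a left vertex together with the difference along an edge gives the root of the
    -- right end, and distinct roots identify that vertex.
    differences-injective : ∀ {ρ x y} → (∀ u v → ρ u ≡ ρ v → u ≡ v) →
                            differences ρ x ≡ differences ρ y → x ≡ y
    differences-injective {ρ} ρ-inj eq = target-injective λ c i →
      ↑ʳ-injective p _ _ (ρ-inj _ _ (xor-cancelˡ (ρ (i ↑ˡ (p + p)))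
        (tabulate-injective (concat-injective (tabulate-injective (concat-injective eq) c)) i)))

    -- Within one injection every left vertex is charged once and every right vertex at most once,
    -- so each of the `k` blocks weighs at most `sum s`.
    weight-differences : ∀ ρ x (s : Fin V → ℕ) →
      (∀ c i → hamming (ρ (i ↑ˡ (p + p))) (ρ (p ↑ʳ target x c i))
               ≤ s (i ↑ˡ (p + p)) + s (p ↑ʳ target x c i)) →
      weight (differences ρ x) ≤ k * sum s
    weight-differences ρ x s h = begin
      weight (differences ρ x)                  ≡⟨ weight-concat {k} _ ⟩
      sum (λ c → weight (Vec.concat (Vec.tabulate (row c))))
                                                ≤⟨ sum-≤-* per-row ⟩
      k * sum s                                 ∎
      where
      open ≤-Reasoning
      row : Fin k → Fin p → Vec Bool d
      row c i = Vec.zipWith _xor_ (ρ (i ↑ˡ (p + p))) (ρ (p ↑ʳ target x c i))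
      per-row : ∀ c → weight (Vec.concat (Vec.tabulate (row c))) ≤ sum s
      per-row c = begin
        weight (Vec.concat (Vec.tabulate (row c)))
          ≡⟨ weight-concat (row c) ⟩
        sum (λ i → weight (row c i))
          ≤⟨ sum-mono (λ i → ≤-trans (≤-reflexive (weight-xor (ρ (i ↑ˡ (p + p))) _)) (h c i)) ⟩
        sum (λ i → sˡ i + sʳ (target x c i))
          ≡⟨ ∑-distrib-+ sˡ (sʳ ∘ target x c) ⟩
        sum sˡ + sum (sʳ ∘ target x c)
          ≤⟨ +-monoʳ-≤ (sum sˡ) (sum-spread-≤ p _ sʳ) ⟩
        sum sˡ + sum sʳ
          ≡⟨ sum-splitAt p s ⟨
        sum s ∎
        where
        sˡ : Fin p → ℕ
        sˡ i = s (i ↑ˡ (p + p))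
        sʳ : Fin (p + p) → ℕ
        sʳ j = s (p ↑ʳ j)

    -- The roots of all vertices, followed by the differences along the encoded edges.
    Code : Set
    Code = Vec Bool (V * d) × Vec Bool (k * (p * d))

    place : Vec Bool (V * d) → Fin V → Vec Bool d
    place φ u = Vec.tabulate λ j → Vec.lookup φ (combine u j)

    -- An arbitrary word `φ` may place two vertices at the same point. Distinctness is therefore
    -- part of the relation, which lets a code determine its graph while keeping the relation
    -- decidable.
    Encodes : Word → Code → Set
    Encodes x (φ , D) = (∀ u v → place φ u ≡ place φ v → u ≡ v) × D ≡ differences (place φ) x

    encodes? : ∀ x y → Dec (Encodes x y)
    encodes? x (φ , D) =
      all? (λ u → all? λ v → Vec-≡-dec Bool._≟_ (place φ u) (place φ v) →-dec (u ≟ v))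
      ×-dec Vec-≡-dec Bool._≟_ D (differences (place φ) x)

    -- For the roots the weight bound equals the length, so all words are listed. For the
    -- differences, `k * 2 ^ d` is `k` times the bound on the total size of the branch sets.
    codes : List Code
    codes = List.cartesianProduct (sparse (V * d) (V * d)) (sparse (k * (p * d)) (k * 2 ^ d))

    length-codes : List.length codes ≤
                   2 ^ (V * d) * List.length (sparse (k * (p * d)) (k * 2 ^ d))
    length-codes = begin
      List.length codes
        ≡⟨ length-cartesianProduct (sparse (V * d) (V * d)) _ ⟩
      List.length (sparse (V * d) (V * d)) * S
        ≤⟨ *-monoˡ-≤ S all-words ⟩
      2 ^ (V * d) * S ∎
      where
      open ≤-Reasoning
      S = List.length (sparse (k * (p * d)) (k * 2 ^ d))
      all-words : List.length (sparse (V * d) (V * d)) ≤ 2 ^ (V * d)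
      all-words = begin
        L                        ≡⟨ *-identityʳ L ⟨
        L * 1                    ≡⟨ cong (L *_) (^-zeroˡ (V * d)) ⟨
        -- The Chernoff bound at `t = 1` is the trivial count of all words.
        L * 1 ^ (V * d)          ≤⟨ length-sparse 1 (V * d) (V * d) ⟩
        1 ^ (V * d) * 2 ^ (V * d)  ≡⟨ cong (_* 2 ^ (V * d)) (^-zeroˡ (V * d)) ⟩
        1 * 2 ^ (V * d)          ≡⟨ *-identityˡ _ ⟩
        2 ^ (V * d)              ∎
        where L = List.length (sparse (V * d) (V * d))

    model-encoded : ∀ {x} → Model d (family x) → Any (Encodes x) codes
    model-encoded {x} M = lose
      (∈-cartesianProduct⁺ (∈-sparse φ (weight≤length φ)) (∈-sparse (differences (place φ) x) light))
      (place-φ-injective , refl)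
      where
      open Model M
      φ : Vec Bool (V * d)
      φ = Vec.concat (Vec.tabulate root)
      place-φ : ∀ u → place φ u ≡ root u
      place-φ u = trans (tabulate-cong λ j → trans (lookup-concat (Vec.tabulate root) u j)
                                   (cong (λ w → Vec.lookup w j) (lookup∘tabulate root u)))
                        (tabulate∘lookup (root u))
      place-φ-injective : ∀ u v → place φ u ≡ place φ v → u ≡ v
      -- Branch sets sharing a root coincide by disjointness.
      place-φ-injective u v eq = disjoint (root∈ u)
        (subst (B v) (trans (≡-sym (place-φ v)) (trans (≡-sym eq) (place-φ u))) (root∈ v))
      light : weight (differences (place φ) x) ≤ k * 2 ^ d
      light = ≤-trans (weight-differences (place φ) x size λ c i → subst₂
          (λ w z → hamming w z ≤ size (i ↑ˡ (p + p)) + size (p ↑ʳ target x c i))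
          (≡-sym (place-φ _)) (≡-sym (place-φ _))
          -- The shift by two skips the auxiliary neighbours; only the injections are encoded.
          (<⇒≤ (adjacent-branches M (bipartite-adj (neighbours x) i (suc (suc c)))
                                  (root∈ _) (root∈ _))))
        (*-monoʳ-≤ k total)

    non-minor : 2 ^ (V * d) * List.length (sparse (k * (p * d)) (k * 2 ^ d)) < (p ^ p) ^ k →
                ∃ λ x → ¬ (family x ≼ Q d)
    non-minor few = let x , ¬coded = uncoded codes Encodes encodes? functional
                                             (≤-<-trans length-codes few)
                    in x , ¬coded ∘ model-encoded ∘ minor-model
      where
      functional : ∀ y {x x′} → Encodes x y → Encodes x′ y → x ≡ x′
      functional (φ , _) (inj , eq) (_ , eq′) = differences-injective {place φ} inj (trans (≡-sym eq) eq′)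

-- Numerical estimates and the choice of the parameter.

^-distribʳ-* : ∀ m a b → (a * b) ^ m ≡ a ^ m * b ^ m
^-distribʳ-* zero    a b = refl
^-distribʳ-* (suc m) a b = trans (cong (a * b *_) (^-distribʳ-* m a b)) (rearrange a b (a ^ m) (b ^ m))
  where
  rearrange : ∀ a b c d → a * b * (c * d) ≡ a * c * (b * d)
  rearrange = solve-∀

-- Chernoff with `t = 32`: the factor `32 ^ w` is `2 ^ (5 * w)`, and since `(33/32)^16 ≤ 2`, every
-- block of 16 positions costs at most one further factor 2.
length-sparse-16 : ∀ m w → List.length (sparse (16 * m) w) ≤ 2 ^ (5 * w + m)
length-sparse-16 m w = *-cancelʳ-≤ _ _ (32 ^ (16 * m)) {{m^n≢0 32 (16 * m)}} (begin
  List.length (sparse (16 * m) w) * 32 ^ (16 * m)  ≤⟨ length-sparse 32 (16 * m) w ⟩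
  32 ^ w * 33 ^ (16 * m)                           ≡⟨ cong₂ _*_ (^-*-assoc 2 5 w) (≡-sym (^-*-assoc 33 16 m)) ⟩
  2 ^ (5 * w) * (33 ^ 16) ^ m
    ≤⟨ *-monoʳ-≤ (2 ^ (5 * w)) (^-monoˡ-≤ m (≤ᵇ⇒≤ (33 ^ 16) (2 * 32 ^ 16) _)) ⟩
  2 ^ (5 * w) * (2 * 32 ^ 16) ^ m                  ≡⟨ cong (2 ^ (5 * w) *_) (^-distribʳ-* m 2 (32 ^ 16)) ⟩
  2 ^ (5 * w) * (2 ^ m * (32 ^ 16) ^ m)
    ≡⟨ cong (λ z → 2 ^ (5 * w) * (2 ^ m * z)) (^-*-assoc 32 16 m) ⟩
  2 ^ (5 * w) * (2 ^ m * 32 ^ (16 * m))            ≡⟨ *-assoc (2 ^ (5 * w)) (2 ^ m) _ ⟨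
  2 ^ (5 * w) * 2 ^ m * 32 ^ (16 * m)
    ≡⟨ cong (_* 32 ^ (16 * m)) (^-distribˡ-+-* 2 (5 * w) m) ⟨
  2 ^ (5 * w + m) * 32 ^ (16 * m)                  ∎)
  where open ≤-Reasoning

floor-log : ∀ d → 1 ≤ d → ∃ λ l → 2 ^ l ≤ d × d < 2 ^ suc l
floor-log (suc zero)    _ = 0 , ≤-refl , ≤-refl
floor-log (suc (suc d)) _ with floor-log (suc d) (s≤s z≤n)
... | l , lo , hi with m≤n⇒m<n∨m≡n hi
...   | inj₁ lt = l , m≤n⇒m≤1+n lo , lt
...   | inj₂ eq = suc l , ≤-reflexive (≡-sym eq) , ≤-<-trans (≤-reflexive eq)
                    (^-monoʳ-< 2 ≤-refl (n<1+n (suc l)))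

2*n≤2^n : ∀ n → 2 * n ≤ 2 ^ n
2*n≤2^n zero          = z≤n
2*n≤2^n (suc zero)    = ≤-refl
2*n≤2^n (suc (suc n)) = begin
  2 * suc (suc n)              ≡⟨ *-suc 2 (suc n) ⟩
  2 + 2 * suc n                ≤⟨ +-mono-≤ (*-monoʳ-≤ 2 (m^n>0 2 n)) (2*n≤2^n (suc n)) ⟩
  2 ^ suc n + 2 ^ suc n        ≡⟨ cong (2 ^ suc n +_) (+-identityʳ (2 ^ suc n)) ⟨
  2 ^ suc (suc n)              ∎
  where open ≤-Reasoning

-- With `l` the rounded-down binary logarithm of `d`, the choice `q = d + 7 - l` makes `2 ^ q`
-- comparable to `2 ^ d / d`. A power of two keeps the later comparison purely one of exponents. The
-- bound `d < 2 * q` holds because `l` is at most `d / 2`.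
left-size : ∀ d → 1 ≤ d → ∃ λ q → d < 2 * q × 2 ^ (d + 7) ≤ 2 ^ q * d × 2 ^ q * d ≤ 2 ^ (d + 8)
left-size d 1≤d with floor-log d 1≤d
... | l , lo , hi = q , d<2q , lower , upper
  where
  open ≤-Reasoning
  q = (d + 7) ∸ l
  2l≤d : 2 * l ≤ d
  2l≤d = ≤-trans (2*n≤2^n l) lo
  q+l : q + l ≡ d + 7
  -- The truncated subtraction is exact because `l ≤ 2 * l ≤ d`.
  q+l = m∸n+n≡m (≤-trans (m≤m+n l (l + 0)) (≤-trans 2l≤d (m≤m+n d 7)))
  d<2q : d < 2 * q
  d<2q = +-cancelʳ-< d d (2 * q) (begin-strict
    d + d          <⟨ m<m+n (d + d) {14} (s≤s z≤n) ⟩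
    d + d + 14     ≡⟨ double d ⟩
    2 * (d + 7)    ≡⟨ cong (2 *_) q+l ⟨
    2 * (q + l)    ≡⟨ *-distribˡ-+ 2 q l ⟩
    2 * q + 2 * l  ≤⟨ +-monoʳ-≤ (2 * q) 2l≤d ⟩
    2 * q + d      ∎)
    where
    double : ∀ d → d + d + 14 ≡ 2 * (d + 7)
    double = solve-∀
  lower : 2 ^ (d + 7) ≤ 2 ^ q * d
  lower = begin
    2 ^ (d + 7)    ≡⟨ cong (2 ^_) q+l ⟨
    2 ^ (q + l)    ≡⟨ ^-distribˡ-+-* 2 q l ⟩
    2 ^ q * 2 ^ l  ≤⟨ *-monoʳ-≤ (2 ^ q) lo ⟩
    2 ^ q * d      ∎
  upper : 2 ^ q * d ≤ 2 ^ (d + 8)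
  upper = begin
    2 ^ q * d          ≤⟨ *-monoʳ-≤ (2 ^ q) (<⇒≤ hi) ⟩
    2 ^ q * 2 ^ suc l  ≡⟨ ^-distribˡ-+-* 2 q (suc l) ⟨
    2 ^ (q + suc l)    ≡⟨ cong (2 ^_) (trans (+-suc q l) (trans (cong suc q+l) (≡-sym (+-suc d 7)))) ⟩
    2 ^ (d + 8)        ∎

-- Compare exponents of 2, with `p = 2 ^ q`: the roots cost `3pd`, the differences at most
-- `80 * 2 ^ d + pd ≤ 2pd`, while the family has exponent `16pq`, and `5pd < 16pq` since `d < 2q`.
few-codes : ∀ d q → 1 ≤ d → d < 2 * q → 2 ^ (d + 7) ≤ 2 ^ q * d →
            2 ^ ((2 ^ q + (2 ^ q + 2 ^ q)) * d) * List.length (sparse (16 * (2 ^ q * d)) (16 * 2 ^ d))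
            < ((2 ^ q) ^ (2 ^ q)) ^ 16
few-codes d q 1≤d d<2q large = begin-strict
  2 ^ ((p + (p + p)) * d) * List.length (sparse (16 * (p * d)) (16 * 2 ^ d))
    ≤⟨ *-monoʳ-≤ (2 ^ ((p + (p + p)) * d)) (length-sparse-16 (p * d) (16 * 2 ^ d)) ⟩
  2 ^ ((p + (p + p)) * d) * 2 ^ (5 * (16 * 2 ^ d) + p * d)
    ≡⟨ ^-distribˡ-+-* 2 ((p + (p + p)) * d) _ ⟨
  2 ^ ((p + (p + p)) * d + (5 * (16 * 2 ^ d) + p * d))
    <⟨ ^-monoʳ-< 2 ≤-refl exponent ⟩
  2 ^ (q * p * 16)
    ≡⟨ ^-*-assoc 2 (q * p) 16 ⟨
  (2 ^ (q * p)) ^ 16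
    ≡⟨ cong (_^ 16) (^-*-assoc 2 q p) ⟨
  (p ^ p) ^ 16 ∎
  where
  open ≤-Reasoning
  p = 2 ^ q
  80*2^d≤pd : 5 * (16 * 2 ^ d) ≤ p * d
  80*2^d≤pd = begin
    5 * (16 * 2 ^ d)  ≡⟨ *-assoc 5 16 (2 ^ d) ⟨
    -- The 7 in `2 ^ (d + 7)` is chosen so that `2 ^ 7` exceeds this 80.
    80 * 2 ^ d        ≤⟨ *-monoˡ-≤ (2 ^ d) (≤ᵇ⇒≤ 80 (2 ^ 7) _) ⟩
    2 ^ 7 * 2 ^ d     ≡⟨ *-comm (2 ^ 7) (2 ^ d) ⟩
    2 ^ d * 2 ^ 7     ≡⟨ ^-distribˡ-+-* 2 d 7 ⟨
    2 ^ (d + 7)       ≤⟨ large ⟩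
    p * d             ∎
  exponent : (p + (p + p)) * d + (5 * (16 * 2 ^ d) + p * d) < q * p * 16
  exponent = begin-strict
    (p + (p + p)) * d + (5 * (16 * 2 ^ d) + p * d)
      ≤⟨ +-monoʳ-≤ ((p + (p + p)) * d) (+-monoˡ-≤ (p * d) 80*2^d≤pd) ⟩
    (p + (p + p)) * d + (p * d + p * d)  ≡⟨ collect p d ⟩
    (5 * p) * d                          ≤⟨ *-monoˡ-≤ d (*-monoˡ-≤ p (≤ᵇ⇒≤ 5 8 _)) ⟩
    -- Rounding 5 up to 8 makes `d < 2 * q` give exactly `16 * p * q`.
    (8 * p) * d                          <⟨ *-monoʳ-< (8 * p) {{m*n≢0 8 p {{_}} {{m^n≢0 2 q}}}} d<2q ⟩
    (8 * p) * (2 * q)                    ≡⟨ regroup p q ⟩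
    q * p * 16                           ∎
    where
    collect : ∀ p d → (p + (p + p)) * d + (p * d + p * d) ≡ (5 * p) * d
    collect = solve-∀
    regroup : ∀ p q → (8 * p) * (2 * q) ≡ q * p * 16
    regroup = solve-∀

-- Assembly of the non-universality bound.

theorem3p1 : ∃ λ (C : ℕ) → 0 < C × ∀ (d : ℕ) → 1 ≤ d →
    ∃ λ (H : Graph) → NoIsolated H × d * edgeCount H ≤ C * 2 ^ d
    × ¬ (H ≼ Q d)
-- Each left vertex has 18 list entries, 16 from the injections and 2 auxiliary ones; `2 ^ 8` comes
-- from `p * d ≤ 2 ^ (d + 8)`.
theorem3p1 = 18 * 2 ^ 8 , s≤s z≤n , λ d 1≤d →
  let q , d<2q , lower , upper = left-size d 1≤d
      open Family (2 ^ q) 16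
      x , ¬minor = non-minor d (few-codes d q 1≤d d<2q lower)
  in family x , family-noIsolated x , few-edges d (2 ^ q) x upper , ¬minor
  where
  open ≤-Reasoning
  few-edges : ∀ d p (x : Family.Word p 16) → p * d ≤ 2 ^ (d + 8) →
              d * edgeCount (Family.family p 16 x) ≤ 18 * 2 ^ 8 * 2 ^ d
  few-edges d p x upper = begin
    d * edgeCount (Family.family p 16 x)
      ≤⟨ *-monoʳ-≤ d (bipartite-edgeCount (Family.neighbours p 16 x)) ⟩
    d * (p * 18)         ≡⟨ regroup d p ⟩
    18 * (p * d)         ≤⟨ *-monoʳ-≤ 18 upper ⟩
    18 * 2 ^ (d + 8)     ≡⟨ cong (18 *_) (trans (^-distribˡ-+-* 2 d 8) (*-comm (2 ^ d) (2 ^ 8))) ⟩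
    18 * (2 ^ 8 * 2 ^ d) ≡⟨ *-assoc 18 (2 ^ 8) (2 ^ d) ⟨
    18 * 2 ^ 8 * 2 ^ d   ∎
    where
    regroup : ∀ d p → d * (p * 18) ≡ 18 * (p * d)
    regroup = solve-∀
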